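{- Let $\mathcal{C}$ be a topos and $F:\mathcal{C}\to\mathcal{C}$ an endofunctor. Let $\alpha:X\to FX$ and $\beta:Y\to FY$ be two $F$-coalgebras, let $\ast$ be an object of $\mathcal{C}$, and let $p:\ast\to X$ and $q:\ast\to Y$ be two morphisms ("points"). The following two statements are equivalent: \begin{enumerate} \item There are a mono $r:R\rightarrowtail X\times Y$ representing a toposal AM-bisimulation from $\alpha$ to $\beta$, and a morphism $c:\ast\to R$ such that $r\cdot c=\langle p,q\rangle$. \item There are a span $X\xleftarrow{f}Z\xrightarrow{g}Y$ in $\mathcal{C}$, a $\mathcal{P}F$-coalgebra structure $\gamma:Z\to\mathcal{P}FZ$, and a morphism $w:\ast\to Z$ such that $f$ is a $\mathcal{P}F$-coalgebra homomorphism from $\gamma$ to $\eta_{FX}\cdot\alpha$, $g$ is a $\mathcal{P}F$-coalgebra homomorphism from $\gamma$ to $\eta_{FY}\cdot\beta$, $f\cdot w=p$ and $g\cdot w=q$. \end{enumerate}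
   Context: A topos is a finitely complete category with power-objects: for every object $X$ there are an object $\mathcal{P}X$ and a mono $\in_X:E_X\rightarrowtail X\times\mathcal{P}X$ such that for every mono $m:R\rightarrowtail X\times Y$ there is a unique morphism $\xi_m:Y\to\mathcal{P}X$ such that $m$ is a pullback of $\in_X$ along $\mathrm{id}_X\times\xi_m$. $\mathcal{P}$ is the covariant functor given on $f:X\to Y$ by $\mathcal{P}f=\xi_{m_f}$, where $m_f$ is the mono part of the (epi, mono)-factorisation of $(f\times\mathrm{id})\cdot\in_X:E_X\to Y\times\mathcal{P}X$, and $\eta_X=\xi_{\langle\mathrm{id},\mathrm{id}\rangle}:X\to\mathcal{P}X$ (the unit of the power-object monad). A $G$-coalgebra for an endofunctor $G$ is a morphism $\alpha:X\to GX$; a $G$-coalgebra homomorphism from $\alpha:X\to GX$ to $\beta:Y\to GY$ is a morphism $f:X\to Y$ with $Gf\cdot\alpha=\beta\cdot f$. $\mathcal{P}F$ denotes the composite functor $\mathcal{P}\circ F$. A relation from $X$ to $Y$ is a subobject of $X\times Y$. Toposal AM-bisimulation: a relation from $X$ to $Y$ is a toposal AM-bisimulation from $\alpha:X\to FX$ to $\beta:Y\to FY$ if for any mono $r:R\rightarrowtail X\times Y$ representing it there is a morphism $W:R\to\mathcal{P}FR$ such that $$(\eta_{FX}\times\eta_{FY})\cdot(\alpha\times\beta)\cdot r=\langle\mathcal{P}F\pi_1,\mathcal{P}F\pi_2\rangle\cdot\mathcal{P}Fr\cdot W:R\to\mathcal{P}FX\times\mathcal{P}FY .$$ -}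

module Defs where

open import Level using (Level; _⊔_) renaming (suc to lsuc)
open import Data.Product using (Σ; Σ-syntax; _×_; _,_; proj₁; proj₂)
open import Relation.Binary.Structures using (IsEquivalence)
open import Relation.Binary.Bundles using (Setoid)
import Relation.Binary.Reasoning.Setoid as SetoidReasoning

private
  variable
    o ℓ e o′ ℓ′ e′ o″ ℓ″ e″ : Level

record Category (o ℓ e : Level) : Set (lsuc (o ⊔ ℓ ⊔ e)) where
  infix  4 _≈_ _⇒_
  infixr 9 _∘_
  field
    Obj : Set o
    _⇒_ : Obj → Obj → Set ℓ
    _≈_ : ∀ {A B} → A ⇒ B → A ⇒ B → Set e
    id  : ∀ {A} → A ⇒ A
    _∘_ : ∀ {A B C} → B ⇒ C → A ⇒ B → A ⇒ C

    assoc     : ∀ {A B C D} {f : A ⇒ B} {g : B ⇒ C} {h : C ⇒ D} →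
                (h ∘ g) ∘ f ≈ h ∘ (g ∘ f)
    identityˡ : ∀ {A B} {f : A ⇒ B} → id ∘ f ≈ f
    identityʳ : ∀ {A B} {f : A ⇒ B} → f ∘ id ≈ f
    equiv     : ∀ {A B} → IsEquivalence (_≈_ {A} {B})
    ∘-resp-≈  : ∀ {A B C} {f h : B ⇒ C} {g i : A ⇒ B} →
                f ≈ h → g ≈ i → f ∘ g ≈ h ∘ i

  homSetoid : Obj → Obj → Setoid ℓ e
  homSetoid A B = record
    { Carrier = A ⇒ B ; _≈_ = _≈_ ; isEquivalence = equiv }

  module Equiv {A B : Obj} = IsEquivalence (equiv {A} {B})
  module HomReasoning {A B : Obj} = SetoidReasoning (homSetoid A B)

  ∘-resp-≈ˡ : ∀ {A B C} {f h : B ⇒ C} {g : A ⇒ B} → f ≈ h → f ∘ g ≈ h ∘ g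
  ∘-resp-≈ˡ p = ∘-resp-≈ p Equiv.refl

  ∘-resp-≈ʳ : ∀ {A B C} {f : B ⇒ C} {g i : A ⇒ B} → g ≈ i → f ∘ g ≈ f ∘ i
  ∘-resp-≈ʳ p = ∘-resp-≈ Equiv.refl p

record Functor (C : Category o ℓ e) (D : Category o′ ℓ′ e′)
       : Set (o ⊔ ℓ ⊔ e ⊔ o′ ⊔ ℓ′ ⊔ e′) where
  private
    module C = Category C
    module D = Category D
  field
    F₀ : C.Obj → D.Obj
    F₁ : ∀ {A B} → A C.⇒ B → F₀ A D.⇒ F₀ B

    identity     : ∀ {A} → F₁ (C.id {A}) D.≈ D.id
    homomorphism : ∀ {A B E} {f : A C.⇒ B} {g : B C.⇒ E} →
                   F₁ (g C.∘ f) D.≈ F₁ g D.∘ F₁ f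
    F-resp-≈     : ∀ {A B} {f g : A C.⇒ B} → f C.≈ g → F₁ f D.≈ F₁ g

Endofunctor : Category o ℓ e → Set (o ⊔ ℓ ⊔ e)
Endofunctor C = Functor C C

infixr 9 _∘F_

_∘F_ : {C : Category o ℓ e} {D : Category o′ ℓ′ e′} {E : Category o″ ℓ″ e″} →
       Functor D E → Functor C D → Functor C E
_∘F_ {E = E} G F = record
  { F₀           = λ A → G.F₀ (F.F₀ A)
  ; F₁           = λ f → G.F₁ (F.F₁ f)
  ; identity     = Equiv.trans (G.F-resp-≈ F.identity) G.identity
  ; homomorphism = Equiv.trans (G.F-resp-≈ F.homomorphism) G.homomorphism
  ; F-resp-≈     = λ p → G.F-resp-≈ (F.F-resp-≈ p)
  }
  where
  module G = Functor G
  module F = Functor F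
  open Category E

module _ {C : Category o ℓ e} (G : Endofunctor C) where
  open Category C
  open Functor G

  Coalgebra : Obj → Set ℓ
  Coalgebra X = X ⇒ F₀ X

  IsCoalgebraHom : ∀ {X Y} → Coalgebra X → Coalgebra Y → X ⇒ Y → Set e
  IsCoalgebraHom α β f = F₁ f ∘ α ≈ β ∘ f

module _ (C : Category o ℓ e) where
  open Category C

  Mono : ∀ {A B} → A ⇒ B → Set (o ⊔ ℓ ⊔ e)
  Mono {A} f = ∀ {T} (u v : T ⇒ A) → f ∘ u ≈ f ∘ v → u ≈ v

  Epi : ∀ {A B} → A ⇒ B → Set (o ⊔ ℓ ⊔ e)
  Epi {B = B} f = ∀ {T} (u v : B ⇒ T) → u ∘ f ≈ v ∘ f → u ≈ v

  FactorsThrough : ∀ {S T A} → T ⇒ A → S ⇒ A → Set (ℓ ⊔ e)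
  FactorsThrough {S} {T} h m = Σ[ k ∈ T ⇒ S ] m ∘ k ≈ h

  -- A subobject is given by a representing mono; which subobject it is
  -- only depends on the mono up to SameSubobject.
  record Subobject (A : Obj) : Set (o ⊔ ℓ ⊔ e) where
    constructor subobject
    field
      {dom} : Obj
      arr   : dom ⇒ A
      mono  : Mono arr

  SameSubobject : ∀ {A} → Subobject A → Subobject A → Set (ℓ ⊔ e)
  SameSubobject S T =
    FactorsThrough (Subobject.arr S) (Subobject.arr T) ×
    FactorsThrough (Subobject.arr T) (Subobject.arr S)

  record EpiMonoFactorisation {A B} (f : A ⇒ B) : Set (o ⊔ ℓ ⊔ e) where
    field
      {image}   : Obj
      epiPart   : A ⇒ image
      monoPart  : image ⇒ B
      epi       : Epi epiPart
      mono      : Mono monoPart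
      factors   : monoPart ∘ epiPart ≈ f

  record Terminal : Set (o ⊔ ℓ ⊔ e) where
    field
      ⊤        : Obj
      !        : ∀ {A} → A ⇒ ⊤
      !-unique : ∀ {A} (f : A ⇒ ⊤) → ! ≈ f

  record Product (A B : Obj) : Set (o ⊔ ℓ ⊔ e) where
    field
      A×B      : Obj
      π₁       : A×B ⇒ A
      π₂       : A×B ⇒ B
      ⟨_,_⟩    : ∀ {T} → T ⇒ A → T ⇒ B → T ⇒ A×B
      project₁ : ∀ {T} {f : T ⇒ A} {g : T ⇒ B} → π₁ ∘ ⟨ f , g ⟩ ≈ f
      project₂ : ∀ {T} {f : T ⇒ A} {g : T ⇒ B} → π₂ ∘ ⟨ f , g ⟩ ≈ g
      unique   : ∀ {T} {h : T ⇒ A×B} {f : T ⇒ A} {g : T ⇒ B} →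
                 π₁ ∘ h ≈ f → π₂ ∘ h ≈ g → ⟨ f , g ⟩ ≈ h

  record Equalizer {A B} (f g : A ⇒ B) : Set (o ⊔ ℓ ⊔ e) where
    field
      {obj}     : Obj
      arr       : obj ⇒ A
      equality  : f ∘ arr ≈ g ∘ arr
      equalize  : ∀ {T} {h : T ⇒ A} → f ∘ h ≈ g ∘ h → T ⇒ obj
      universal : ∀ {T} {h : T ⇒ A} {p : f ∘ h ≈ g ∘ h} → arr ∘ equalize p ≈ h
      unique    : ∀ {T} {h : T ⇒ A} {p : f ∘ h ≈ g ∘ h} {k : T ⇒ obj} →
                  arr ∘ k ≈ h → k ≈ equalize p

  -- The square
  --      P --p₂--> B
  --   p₁ |         | g
  --      A --f---> D
  record IsPullback {P A B D} (p₁ : P ⇒ A) (p₂ : P ⇒ B) (f : A ⇒ D) (g : B ⇒ D)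
         : Set (o ⊔ ℓ ⊔ e) where
    field
      commute   : f ∘ p₁ ≈ g ∘ p₂
      universal : ∀ {T} {h₁ : T ⇒ A} {h₂ : T ⇒ B} → f ∘ h₁ ≈ g ∘ h₂ → T ⇒ P
      p₁∘universal : ∀ {T} {h₁ : T ⇒ A} {h₂ : T ⇒ B} {eq : f ∘ h₁ ≈ g ∘ h₂} →
                     p₁ ∘ universal eq ≈ h₁
      p₂∘universal : ∀ {T} {h₁ : T ⇒ A} {h₂ : T ⇒ B} {eq : f ∘ h₁ ≈ g ∘ h₂} →
                     p₂ ∘ universal eq ≈ h₂
      unique    : ∀ {T} {h₁ : T ⇒ A} {h₂ : T ⇒ B} {eq : f ∘ h₁ ≈ g ∘ h₂}
                  {k : T ⇒ P} → p₁ ∘ k ≈ h₁ → p₂ ∘ k ≈ h₂ → k ≈ universal eq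

  IsPullbackOfAlong : ∀ {P A B D} → P ⇒ A → B ⇒ D → A ⇒ D → Set (o ⊔ ℓ ⊔ e)
  IsPullbackOfAlong {P} {A} {B} m g f = Σ[ t ∈ P ⇒ B ] IsPullback m t f g

  -- All finite limits, presented as usual by finite products and equalizers.
  record FinitelyComplete : Set (o ⊔ ℓ ⊔ e) where
    field
      terminal  : Terminal
      product   : ∀ A B → Product A B
      equalizer : ∀ {A B} (f g : A ⇒ B) → Equalizer f g

    open Terminal terminal public

    infixr 7 _×ₒ_
    infixr 8 _×₁_

    _×ₒ_ : Obj → Obj → Obj
    A ×ₒ B = Product.A×B (product A B)

    module _ {A B : Obj} where
      open Product (product A B) public
        using (π₁; π₂; ⟨_,_⟩; project₁; project₂)
        renaming (unique to ⟨⟩-unique)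

    _×₁_ : ∀ {A B A′ B′} → A ⇒ A′ → B ⇒ B′ → A ×ₒ B ⇒ A′ ×ₒ B′
    f ×₁ g = ⟨ f ∘ π₁ , g ∘ π₂ ⟩

module _ (C : Category o ℓ e) (lim : FinitelyComplete C) where
  open Category C
  open FinitelyComplete lim

  record PowerObject (X : Obj) : Set (o ⊔ ℓ ⊔ e) where
    field
      𝒫₀     : Obj
      E      : Obj
      ∈      : E ⇒ X ×ₒ 𝒫₀
      ∈-mono : Mono C ∈

      ξ          : ∀ {R Y} (m : R ⇒ X ×ₒ Y) → Mono C m → Y ⇒ 𝒫₀
      ξ-pullback : ∀ {R Y} (m : R ⇒ X ×ₒ Y) (mono : Mono C m) →
                   IsPullbackOfAlong C m ∈ (id ×₁ ξ m mono)
      ξ-unique   : ∀ {R Y} (m : R ⇒ X ×ₒ Y) (mono : Mono C m) (h : Y ⇒ 𝒫₀) →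
                   IsPullbackOfAlong C m ∈ (id ×₁ h) → h ≈ ξ m mono

record Topos (o ℓ e : Level) : Set (lsuc (o ⊔ ℓ ⊔ e)) where
  field
    category         : Category o ℓ e
    finitelyComplete : FinitelyComplete category
    powerObject      : ∀ X → PowerObject category finitelyComplete X

module ToposTheory (𝒞 : Topos o ℓ e) where
  open Topos 𝒞 public
  open Category category public
  open FinitelyComplete finitelyComplete public

  private
    module PO X = PowerObject (powerObject X)

  open PO public using (𝒫₀; E; ∈; ∈-mono)
  open module POᵢ {X} = PO X public using (ξ; ξ-pullback; ξ-unique)

  private
    C = category

  open Equiv
  open HomReasoning

  infix 4 _liesIn_

  _liesIn_ : ∀ {S T A} → T ⇒ A → S ⇒ A → Set (ℓ ⊔ e)
  h liesIn m = FactorsThrough C h m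

  pullˡ : ∀ {A B D E} {f : D ⇒ E} {g : B ⇒ D} {h : A ⇒ B} {k : B ⇒ E} →
          f ∘ g ≈ k → f ∘ (g ∘ h) ≈ k ∘ h
  pullˡ p = trans (sym assoc) (∘-resp-≈ˡ p)

  pullʳ : ∀ {A B D E} {f : D ⇒ E} {g : B ⇒ D} {h : A ⇒ B} {k : A ⇒ D} →
          g ∘ h ≈ k → (f ∘ g) ∘ h ≈ f ∘ k
  pullʳ p = trans assoc (∘-resp-≈ʳ p)

  ⟨⟩-cong : ∀ {T A B} {f f′ : T ⇒ A} {g g′ : T ⇒ B} →
            f ≈ f′ → g ≈ g′ → ⟨ f , g ⟩ ≈ ⟨ f′ , g′ ⟩
  ⟨⟩-cong p q = ⟨⟩-unique (trans project₁ (sym p)) (trans project₂ (sym q))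

  ⟨⟩-∘ : ∀ {S T A B} {f : T ⇒ A} {g : T ⇒ B} {h : S ⇒ T} →
         ⟨ f , g ⟩ ∘ h ≈ ⟨ f ∘ h , g ∘ h ⟩
  ⟨⟩-∘ = sym (⟨⟩-unique (pullˡ project₁) (pullˡ project₂))

  ⟨⟩-η : ∀ {T A B} {h : T ⇒ A ×ₒ B} → ⟨ π₁ ∘ h , π₂ ∘ h ⟩ ≈ h
  ⟨⟩-η = ⟨⟩-unique refl refl

  ⟨⟩-inj₁ : ∀ {T A B} {f f′ : T ⇒ A} {g g′ : T ⇒ B} →
            ⟨ f , g ⟩ ≈ ⟨ f′ , g′ ⟩ → f ≈ f′
  ⟨⟩-inj₁ p = trans (sym project₁) (trans (∘-resp-≈ʳ p) project₁)

  ⟨⟩-inj₂ : ∀ {T A B} {f f′ : T ⇒ A} {g g′ : T ⇒ B} →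
            ⟨ f , g ⟩ ≈ ⟨ f′ , g′ ⟩ → g ≈ g′
  ⟨⟩-inj₂ p = trans (sym project₂) (trans (∘-resp-≈ʳ p) project₂)

  ×₁-⟨⟩ : ∀ {T A B A′ B′} {f : A ⇒ A′} {g : B ⇒ B′} {a : T ⇒ A} {b : T ⇒ B} →
          (f ×₁ g) ∘ ⟨ a , b ⟩ ≈ ⟨ f ∘ a , g ∘ b ⟩
  ×₁-⟨⟩ = trans ⟨⟩-∘ (⟨⟩-cong (pullʳ project₁) (pullʳ project₂))

  id×₁-⟨⟩ : ∀ {T A B B′} {g : B ⇒ B′} {a : T ⇒ A} {b : T ⇒ B} →
            (id ×₁ g) ∘ ⟨ a , b ⟩ ≈ ⟨ a , g ∘ b ⟩
  id×₁-⟨⟩ = trans ×₁-⟨⟩ (⟨⟩-cong identityˡ refl)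

  id-mono : ∀ {A} → Mono C (id {A})
  id-mono u v p = trans (sym identityˡ) (trans p identityˡ)

  graph-mono : ∀ {A B} (f : A ⇒ B) → Mono C ⟨ id , f ⟩
  graph-mono f u v p = id-mono u v (⟨⟩-inj₁ (trans (sym ⟨⟩-∘) (trans p ⟨⟩-∘)))

  equalizer-mono : ∀ {A B} {f g : A ⇒ B} (E : Equalizer C f g) →
                   Mono C (Equalizer.arr E)
  equalizer-mono {f = f} {g} E u v p =
    trans (Equalizer.unique E {p = q} p) (sym (Equalizer.unique E refl))
    where
    open Equalizer E using (arr; equality)
    q : f ∘ (arr ∘ v) ≈ g ∘ (arr ∘ v)
    q = trans (pullˡ equality) assoc

  record Pullback {A B D} (f : A ⇒ D) (g : B ⇒ D) : Set (o ⊔ ℓ ⊔ e) where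
    field
      {obj}      : Obj
      p₁         : obj ⇒ A
      p₂         : obj ⇒ B
      isPullback : IsPullback C p₁ p₂ f g
    open IsPullback isPullback public

    jointly-monic : ∀ {T} {u v : T ⇒ obj} →
                    p₁ ∘ u ≈ p₁ ∘ v → p₂ ∘ u ≈ p₂ ∘ v → u ≈ v
    jointly-monic {u = u} {v} p q = trans (unique {eq = r} p q) (sym (unique refl refl))
      where
      r : f ∘ (p₁ ∘ v) ≈ g ∘ (p₂ ∘ v)
      r = trans (pullˡ commute) assoc

    p₁-mono : Mono C g → Mono C p₁
    p₁-mono g-mono u v p = jointly-monic p (g-mono _ _ (begin
      g ∘ (p₂ ∘ u)  ≈⟨ pullˡ (sym commute) ⟩
      (f ∘ p₁) ∘ u  ≈⟨ pullʳ p ⟩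
      f ∘ (p₁ ∘ v)  ≈⟨ pullˡ commute ⟩
      (g ∘ p₂) ∘ v  ≈⟨ assoc ⟩
      g ∘ (p₂ ∘ v)  ∎))

    p₁-factors : ∀ {T} {h : T ⇒ A} → f ∘ h liesIn g → h liesIn p₁
    p₁-factors (k , p) = universal (sym p) , p₁∘universal

    p₁-factors⁻¹ : ∀ {T} {h : T ⇒ A} → h liesIn p₁ → f ∘ h liesIn g
    p₁-factors⁻¹ (k , p) = p₂ ∘ k ,
      trans (pullˡ (sym commute)) (pullʳ p)

  pullback : ∀ {A B D} (f : A ⇒ D) (g : B ⇒ D) → Pullback f g
  pullback f g = record
    { p₁ = π₁ ∘ arr
    ; p₂ = π₂ ∘ arr
    ; isPullback = record
      { commute      = trans (sym assoc) (trans equality assoc)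
      ; universal    = λ p → equalize (lift p)
      ; p₁∘universal = trans (pullʳ universal) project₁
      ; p₂∘universal = trans (pullʳ universal) project₂
      ; unique       = λ p q → equalizer-mono eqz _ _ (trans
          (sym (⟨⟩-unique (trans (sym assoc) p) (trans (sym assoc) q)))
          (sym universal))
      }
    }
    where
    eqz = equalizer (f ∘ π₁) (g ∘ π₂)
    open Equalizer eqz hiding (unique)
    lift : ∀ {T} {h₁ : T ⇒ _} {h₂ : T ⇒ _} → f ∘ h₁ ≈ g ∘ h₂ →
           (f ∘ π₁) ∘ ⟨ h₁ , h₂ ⟩ ≈ (g ∘ π₂) ∘ ⟨ h₁ , h₂ ⟩
    lift p = trans (pullʳ project₁) (trans p (sym (pullʳ project₂)))

  liesIn-resp : ∀ {S T A} {h h′ : T ⇒ A} {m : S ⇒ A} →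
                h ≈ h′ → h liesIn m → h′ liesIn m
  liesIn-resp p (k , q) = k , trans q p

  liesIn-∘ : ∀ {S T T′ A} {h : T ⇒ A} {m : S ⇒ A} (t : T′ ⇒ T) →
             h liesIn m → h ∘ t liesIn m
  liesIn-∘ t (k , q) = k ∘ t , pullˡ q

  -- Generalised elements of power objects: a ∈[ b ] says that the
  -- T-element a of X belongs to the T-element b of 𝒫X.

  infix 4 _∈[_]

  _∈[_] : ∀ {T X} → T ⇒ X → T ⇒ 𝒫₀ X → Set (ℓ ⊔ e)
  a ∈[ b ] = ⟨ a , b ⟩ liesIn ∈ _

  ∈-resp : ∀ {T X} {a a′ : T ⇒ X} {b b′ : T ⇒ 𝒫₀ X} →
           a ≈ a′ → b ≈ b′ → a ∈[ b ] → a′ ∈[ b′ ]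
  ∈-resp p q = liesIn-resp (⟨⟩-cong p q)

  ∈-∘ : ∀ {T T′ X} {a : T ⇒ X} {b : T ⇒ 𝒫₀ X} (t : T′ ⇒ T) →
        a ∈[ b ] → a ∘ t ∈[ b ∘ t ]
  ∈-∘ t p = liesIn-resp ⟨⟩-∘ (liesIn-∘ t p)

  module _ {X Y R} (m : R ⇒ X ×ₒ Y) (mono : Mono C m) where
    private
      pb : Pullback (id ×₁ ξ m mono) (∈ X)
      pb = record { isPullback = proj₂ (ξ-pullback m mono) }

    ξ-intro : ∀ {T} {a : T ⇒ X} {b : T ⇒ Y} →
              ⟨ a , b ⟩ liesIn m → a ∈[ ξ m mono ∘ b ]
    ξ-intro p = liesIn-resp id×₁-⟨⟩ (Pullback.p₁-factors⁻¹ pb p)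

    ξ-elim : ∀ {T} {a : T ⇒ X} {b : T ⇒ Y} →
             a ∈[ ξ m mono ∘ b ] → ⟨ a , b ⟩ liesIn m
    ξ-elim p = Pullback.p₁-factors pb (liesIn-resp (sym id×₁-⟨⟩) p)

  𝒫-ext : ∀ {X Y} {h h′ : Y ⇒ 𝒫₀ X} →
          (∀ {T} (a : T ⇒ X) (b : T ⇒ Y) → a ∈[ h ∘ b ] → a ∈[ h′ ∘ b ]) →
          (∀ {T} (a : T ⇒ X) (b : T ⇒ Y) → a ∈[ h′ ∘ b ] → a ∈[ h ∘ b ]) →
          h ≈ h′
  𝒫-ext {X} {Y} {h} {h′} to from =
    trans (ξ-unique p₁ mono h (p₂ , isPullback))
          (sym (ξ-unique p₁ mono h′ (proj₁ in′ , isPullback′)))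
    where
    open Pullback (pullback (id ×₁ h) (∈ X))
    mono = p₁-mono (∈-mono X)

    split : ∀ {T} (g : Y ⇒ 𝒫₀ X) (q : T ⇒ X ×ₒ Y) →
            (id ×₁ g) ∘ q ≈ ⟨ π₁ ∘ q , g ∘ (π₂ ∘ q) ⟩
    split g q = trans (∘-resp-≈ʳ (sym ⟨⟩-η)) id×₁-⟨⟩

    in′ : (id ×₁ h′) ∘ p₁ liesIn ∈ X
    in′ = liesIn-resp (sym (split h′ p₁))
            (to _ _ (liesIn-resp (split h p₁) (p₂ , sym commute)))

    back : ∀ {T} {q : T ⇒ X ×ₒ Y} → (id ×₁ h′) ∘ q liesIn ∈ X → q liesIn p₁
    back {q = q} p = p₁-factors (liesIn-resp (sym (split h q))
                       (from _ _ (liesIn-resp (split h′ q) p)))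

    isPullback′ : IsPullback C p₁ (proj₁ in′) (id ×₁ h′) (∈ X)
    isPullback′ = record
      { commute      = sym (proj₂ in′)
      ; universal    = λ p → proj₁ (back (_ , sym p))
      ; p₁∘universal = λ {_} {_} {_} {p} → proj₂ (back (_ , sym p))
      ; p₂∘universal = λ {_} {_} {_} {p} → ∈-mono X _ _
          (trans (pullˡ (proj₂ in′)) (trans (pullʳ (proj₂ (back (_ , sym p)))) p))
      ; unique       = λ {_} {_} {_} {p} q _ →
          mono _ _ (trans q (sym (proj₂ (back (_ , sym p)))))
      }

  -- Epi-mono factorisations: the image of f : X → Y is carved out of Y as
  -- the intersection of all subobjects of Y containing f.

  -- The subobject { b | ∀ a. (a , b) ∈ m } of B.
  module Forall {A B R} (m : R ⇒ A ×ₒ B) (mono : Mono C m) where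
    open Equalizer (equalizer (ξ m mono) (ξ id id-mono)) public using (obj; arr)
    private
      eqz = equalizer (ξ m mono) (ξ id id-mono)
      module Eq = Equalizer eqz

    arr-mono : Mono C arr
    arr-mono = equalizer-mono eqz

    intro : ∀ {T} {b : T ⇒ B} →
            (∀ {T′} (t : T′ ⇒ T) (a : T′ ⇒ A) → ⟨ a , b ∘ t ⟩ liesIn m) →
            b liesIn arr
    intro {b = b} all = Eq.equalize eq , Eq.universal
      where
      eq : ξ m mono ∘ b ≈ ξ id id-mono ∘ b
      eq = 𝒫-ext
        (λ a t _ → ∈-resp refl (sym assoc) (ξ-intro id id-mono (_ , identityˡ)))
        (λ a t _ → ∈-resp refl (sym assoc) (ξ-intro m mono (all t a)))

    elim : ∀ {T} {b : T ⇒ B} → b liesIn arr → (a : T ⇒ A) → ⟨ a , b ⟩ liesIn m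
    elim {b = b} (k , p) a = ξ-elim m mono
      (∈-resp refl eq (ξ-intro id id-mono (_ , identityˡ)))
      where
      eq : ξ id id-mono ∘ b ≈ ξ m mono ∘ b
      eq = begin
        ξ id id-mono ∘ b          ≈⟨ ∘-resp-≈ʳ p ⟨
        ξ id id-mono ∘ (arr ∘ k)  ≈⟨ pullˡ (sym Eq.equality) ⟩
        (ξ m mono ∘ arr) ∘ k      ≈⟨ pullʳ p ⟩
        ξ m mono ∘ b              ∎

  module Image {X Y} (f : X ⇒ Y) where
    private
      -- K = { S ∈ 𝒫Y | ∀ x. f x ∈ S }
      module Q = Pullback (pullback (f ×₁ id) (∈ Y))
      module K = Forall Q.p₁ (Q.p₁-mono (∈-mono Y))

      -- I = { y ∈ Y | ∀ S ∈ K. y ∈ S }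
      swap : K.obj ×ₒ Y ⇒ Y ×ₒ 𝒫₀ Y
      swap = ⟨ π₂ , K.arr ∘ π₁ ⟩
      module L = Pullback (pullback swap (∈ Y))
      module I = Forall L.p₁ (L.p₁-mono (∈-mono Y))

      swap-⟨⟩ : ∀ {T} {s : T ⇒ K.obj} {y : T ⇒ Y} →
                swap ∘ ⟨ s , y ⟩ ≈ ⟨ y , K.arr ∘ s ⟩
      swap-⟨⟩ = trans ⟨⟩-∘ (⟨⟩-cong project₂ (pullʳ project₁))

      f×id-⟨⟩ : ∀ {T} {x : T ⇒ X} {s : T ⇒ 𝒫₀ Y} →
                (f ×₁ id) ∘ ⟨ x , s ⟩ ≈ ⟨ f ∘ x , s ⟩
      f×id-⟨⟩ = trans ×₁-⟨⟩ (⟨⟩-cong refl identityˡ)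

      f-in-I : f liesIn I.arr
      f-in-I = I.intro λ t s → L.p₁-factors (liesIn-resp (sym swap-⟨⟩)
        (liesIn-resp f×id-⟨⟩ (Q.p₁-factors⁻¹ (K.elim (s , refl) t))))

      -- I is the least subobject containing f.
      least : ∀ {S} (n : S ⇒ Y) → Mono C n → f liesIn n → I.arr liesIn n
      least {S} n n-mono (g , ng≈f) = proj₁ I-in , ⟨⟩-inj₁ (trans (sym ⟨⟩-∘) (proj₂ I-in))
        where
        N : S ⇒ Y ×ₒ ⊤
        N = ⟨ n , ! ⟩
        N-mono : Mono C N
        N-mono u v p = n-mono u v (⟨⟩-inj₁ (trans (sym ⟨⟩-∘) (trans p ⟨⟩-∘)))

        name-in-K : ξ N N-mono liesIn K.arr
        name-in-K = K.intro λ t x → Q.p₁-factors (liesIn-resp (sym f×id-⟨⟩)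
          (ξ-intro N N-mono (g ∘ x ,
            trans ⟨⟩-∘ (⟨⟩-cong (pullˡ ng≈f) (trans (sym (!-unique _)) (!-unique t))))))

        I-in : ⟨ I.arr , ! ⟩ liesIn N
        I-in = ξ-elim N N-mono (∈-resp refl (pullˡ (proj₂ name-in-K))
          (liesIn-resp swap-⟨⟩ (L.p₁-factors⁻¹
            (I.elim (id , identityʳ) (proj₁ name-in-K ∘ !)))))

      I-epi : Epi C (proj₁ f-in-I)
      I-epi u v p = begin
        u                   ≈⟨ identityʳ ⟨
        u ∘ id              ≈⟨ ∘-resp-≈ʳ split ⟨
        u ∘ (arr ∘ k)       ≈⟨ pullˡ equality ⟩
        (v ∘ arr) ∘ k       ≈⟨ pullʳ split ⟩
        v ∘ id              ≈⟨ identityʳ ⟩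
        v                   ∎
        where
        eqz = equalizer u v
        open Equalizer eqz using (arr; equality; equalize; universal)
        l : I.arr liesIn (I.arr ∘ arr)
        l = least (I.arr ∘ arr)
          (λ a b q → equalizer-mono eqz a b
            (I.arr-mono _ _ (trans (sym assoc) (trans q assoc))))
          (equalize p , trans (pullʳ universal) (proj₂ f-in-I))
        k = proj₁ l
        split : arr ∘ k ≈ id
        split = I.arr-mono _ _ (trans (sym assoc) (trans (proj₂ l) (sym identityʳ)))

    -- Opaque: epi-mono factorisations are unique up to isomorphism, so nothing
    -- depends on this particular construction.
    opaque
      factorisation : EpiMonoFactorisation C f
      factorisation = record
        { epiPart  = proj₁ f-in-I
        ; monoPart = I.arr
        ; epi      = I-epi
        ; mono     = I.arr-mono
        ; factors  = proj₂ f-in-I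
        }

  module Im {X Y} (f : X ⇒ Y) = EpiMonoFactorisation (Image.factorisation f)

  -- Epis are covers: they are stable under pullback, and factoring
  -- through a mono can be checked after precomposing with an epi.

  epi-stable : ∀ {X I J} {q : X ⇒ I} {h : J ⇒ I} → Epi C q →
               (P : Pullback h q) → Epi C (Pullback.p₁ P)
  epi-stable {X} {I} {J} {q} {h} q-epi P u v p = begin
    u              ≈⟨ identityʳ ⟨
    u ∘ id         ≈⟨ ∘-resp-≈ʳ split ⟨
    u ∘ (arr ∘ k)  ≈⟨ pullˡ equality ⟩
    (v ∘ arr) ∘ k  ≈⟨ pullʳ split ⟩
    v ∘ id         ≈⟨ identityʳ ⟩
    v              ∎
    where
    module P = Pullback P
    eqz = equalizer u v
    open Equalizer eqz using (arr; equality; equalize; universal)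

    G = ⟨ id , h ⟩
    G-mono = graph-mono h
    G′-mono : Mono C (G ∘ arr)
    G′-mono a b r = equalizer-mono eqz a b
      (G-mono _ _ (trans (sym assoc) (trans r assoc)))

    agree : ξ G G-mono ≈ ξ (G ∘ arr) G′-mono
    agree = q-epi _ _ (𝒫-ext to from)
      where
      to : ∀ {T} (a : T ⇒ J) (x : T ⇒ X) →
           a ∈[ (ξ G G-mono ∘ q) ∘ x ] → a ∈[ (ξ (G ∘ arr) G′-mono ∘ q) ∘ x ]
      to {T} a x r = ∈-resp refl (sym assoc) (ξ-intro (G ∘ arr) G′-mono
        (equalize p ∘ P.universal hk≈qx , (begin
          (G ∘ arr) ∘ (equalize p ∘ P.universal hk≈qx)  ≈⟨ pullʳ (pullˡ universal) ⟩
          G ∘ (P.p₁ ∘ P.universal hk≈qx)                ≈⟨ ∘-resp-≈ʳ P.p₁∘universal ⟩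
          G ∘ k₀                                        ≈⟨ proj₂ s ⟩
          ⟨ a , q ∘ x ⟩                                 ∎)))
        where
        s : ⟨ a , q ∘ x ⟩ liesIn G
        s = ξ-elim G G-mono (∈-resp refl assoc r)
        k₀ = proj₁ s
        hk≈qx : h ∘ k₀ ≈ q ∘ x
        hk≈qx = ⟨⟩-inj₂ (trans (sym ⟨⟩-∘) (proj₂ s))

      from : ∀ {T} (a : T ⇒ J) (x : T ⇒ X) →
             a ∈[ (ξ (G ∘ arr) G′-mono ∘ q) ∘ x ] → a ∈[ (ξ G G-mono ∘ q) ∘ x ]
      from a x r with ξ-elim (G ∘ arr) G′-mono (∈-resp refl assoc r)
      ... | k₀ , s = ∈-resp refl (sym assoc)
                       (ξ-intro G G-mono (arr ∘ k₀ , trans (sym assoc) s))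

    id-in : G liesIn (G ∘ arr)
    id-in = ξ-elim (G ∘ arr) G′-mono (∈-resp refl (∘-resp-≈ˡ agree)
              (ξ-intro G G-mono (id , identityʳ)))
    k = proj₁ id-in
    split : arr ∘ k ≈ id
    split = G-mono _ _ (trans (sym assoc) (trans (proj₂ id-in) (sym identityʳ)))

  epi-∘ : ∀ {A B D} {g : B ⇒ D} {f : A ⇒ B} → Epi C g → Epi C f → Epi C (g ∘ f)
  epi-∘ g-epi f-epi u v p =
    g-epi u v (f-epi _ _ (trans assoc (trans p (sym assoc))))

  -- Every mono is an equalizer, hence orthogonal to epis.
  local : ∀ {S T T′ A} {h : T ⇒ A} {m : S ⇒ A} (t : T′ ⇒ T) →
          Epi C t → Mono C m → h ∘ t liesIn m → h liesIn m
  local {S} {A = A} {h} {m} t t-epi m-mono (k , p) =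
    liesIn-resp project₂ (liesIn-∘-cancel (N.elim (Eq.equalize eq′ , Eq.universal) !))
    where
    M : S ⇒ ⊤ ×ₒ A
    M = ⟨ ! , m ⟩
    M-mono : Mono C M
    M-mono a b r = m-mono a b (⟨⟩-inj₂ (trans (sym ⟨⟩-∘) (trans r ⟨⟩-∘)))
    module N = Forall M M-mono
    module Eq = Equalizer (equalizer (ξ M M-mono) (ξ id id-mono))

    ht-in : h ∘ t liesIn N.arr
    ht-in = N.intro λ s a → k ∘ s ,
      trans ⟨⟩-∘ (⟨⟩-cong (trans (sym (!-unique _)) (!-unique a)) (pullˡ p))

    eq′ : ξ M M-mono ∘ h ≈ ξ id id-mono ∘ h
    eq′ = t-epi _ _ (begin
      (ξ M M-mono ∘ h) ∘ t               ≈⟨ pullʳ (sym (proj₂ ht-in)) ⟩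
      ξ M M-mono ∘ (N.arr ∘ proj₁ ht-in) ≈⟨ pullˡ Eq.equality ⟩
      (ξ id id-mono ∘ N.arr) ∘ proj₁ ht-in ≈⟨ pullʳ (proj₂ ht-in) ⟩
      ξ id id-mono ∘ (h ∘ t)             ≈⟨ assoc ⟨
      (ξ id id-mono ∘ h) ∘ t             ∎)

    liesIn-∘-cancel : ∀ {a} → ⟨ a , h ⟩ liesIn M → π₂ {⊤} ∘ ⟨ a , h ⟩ liesIn m
    liesIn-∘-cancel (j , r) = j , trans (pushπ) (∘-resp-≈ʳ r)
      where
      pushπ : m ∘ j ≈ π₂ ∘ (M ∘ j)
      pushπ = sym (pullˡ project₂)

  direct : ∀ {X Y} (f : X ⇒ Y) → E X ⇒ Y ×ₒ 𝒫₀ X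
  direct {X} f = (f ×₁ id) ∘ ∈ X

  𝒫₁ : ∀ {X Y} → X ⇒ Y → 𝒫₀ X ⇒ 𝒫₀ Y
  𝒫₁ f = ξ (Im.monoPart (direct f)) (Im.mono (direct f))

  -- y ∈ 𝒫f(b) iff, locally, y = f x for some x ∈ b.
  record Witness {X Y T} (f : X ⇒ Y) (y : T ⇒ Y) (b : T ⇒ 𝒫₀ X) : Set (o ⊔ ℓ ⊔ e) where
    field
      {cover}   : Obj
      t         : cover ⇒ T
      t-epi     : Epi C t
      x         : cover ⇒ X
      member    : x ∈[ b ∘ t ]
      over      : f ∘ x ≈ y ∘ t

  𝒫₁-elim : ∀ {X Y T} {f : X ⇒ Y} {y : T ⇒ Y} {b : T ⇒ 𝒫₀ X} →
            y ∈[ 𝒫₁ f ∘ b ] → Witness f y b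
  𝒫₁-elim {X} {Y} {T} {f} {y} {b} r = record
    { t      = P.p₁
    ; t-epi  = epi-stable epi pb
    ; x      = π₁ ∘ (∈ X ∘ P.p₂)
    ; member = P.p₂ , (begin
        ∈ X ∘ P.p₂                                     ≈⟨ ⟨⟩-η ⟨
        ⟨ π₁ ∘ (∈ X ∘ P.p₂) , π₂ ∘ (∈ X ∘ P.p₂) ⟩     ≈⟨ ⟨⟩-cong refl eq₂ ⟩
        ⟨ π₁ ∘ (∈ X ∘ P.p₂) , b ∘ P.p₁ ⟩              ∎)
    ; over   = eq₁
    }
    where
    open Im (direct f)
    s : ⟨ y , b ⟩ liesIn monoPart
    s = ξ-elim monoPart mono r
    pb = pullback (proj₁ s) epiPart
    module P = Pullback pb

    key : ⟨ f ∘ (π₁ ∘ (∈ X ∘ P.p₂)) , id ∘ (π₂ ∘ (∈ X ∘ P.p₂)) ⟩ ≈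
          ⟨ y ∘ P.p₁ , b ∘ P.p₁ ⟩
    key = begin
      ⟨ f ∘ (π₁ ∘ (∈ X ∘ P.p₂)) , id ∘ (π₂ ∘ (∈ X ∘ P.p₂)) ⟩ ≈⟨ ×₁-⟨⟩ ⟨
      (f ×₁ id) ∘ ⟨ π₁ ∘ (∈ X ∘ P.p₂) , π₂ ∘ (∈ X ∘ P.p₂) ⟩  ≈⟨ ∘-resp-≈ʳ ⟨⟩-η ⟩
      (f ×₁ id) ∘ (∈ X ∘ P.p₂)           ≈⟨ pullˡ (sym factors) ⟩
      (monoPart ∘ epiPart) ∘ P.p₂        ≈⟨ pullʳ (sym P.commute) ⟩
      monoPart ∘ (proj₁ s ∘ P.p₁)        ≈⟨ pullˡ (proj₂ s) ⟩
      ⟨ y , b ⟩ ∘ P.p₁                   ≈⟨ ⟨⟩-∘ ⟩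
      ⟨ y ∘ P.p₁ , b ∘ P.p₁ ⟩            ∎

    eq₁ : f ∘ (π₁ ∘ (∈ X ∘ P.p₂)) ≈ y ∘ P.p₁
    eq₁ = ⟨⟩-inj₁ key
    eq₂ : π₂ ∘ (∈ X ∘ P.p₂) ≈ b ∘ P.p₁
    eq₂ = trans (sym identityˡ) (⟨⟩-inj₂ key)

  𝒫₁-intro : ∀ {X Y T} {f : X ⇒ Y} {y : T ⇒ Y} {b : T ⇒ 𝒫₀ X} →
             Witness f y b → y ∈[ 𝒫₁ f ∘ b ]
  𝒫₁-intro {X} {f = f} {y} {b} w = ξ-intro monoPart mono
    (local W.t W.t-epi mono (epiPart ∘ k , (begin
      monoPart ∘ (epiPart ∘ k)     ≈⟨ pullˡ factors ⟩
      direct f ∘ k                 ≈⟨ pullʳ (proj₂ W.member) ⟩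
      (f ×₁ id) ∘ ⟨ W.x , b ∘ W.t ⟩ ≈⟨ ×₁-⟨⟩ ⟩
      ⟨ f ∘ W.x , id ∘ (b ∘ W.t) ⟩ ≈⟨ ⟨⟩-cong W.over identityˡ ⟩
      ⟨ y ∘ W.t , b ∘ W.t ⟩        ≈⟨ ⟨⟩-∘ ⟨
      ⟨ y , b ⟩ ∘ W.t              ∎)))
    where
    open Im (direct f)
    module W = Witness w
    k = proj₁ W.member

  ∈-local : ∀ {T T′ X} {a : T ⇒ X} {b : T ⇒ 𝒫₀ X} (t : T′ ⇒ T) → Epi C t →
            a ∘ t ∈[ b ∘ t ] → a ∈[ b ]
  ∈-local {X = X} t t-epi r =
    local t t-epi (∈-mono X) (liesIn-resp (sym ⟨⟩-∘) r)

  id-epi : ∀ {A} → Epi C (id {A})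
  id-epi u v p = trans (sym identityʳ) (trans p identityʳ)

  𝒫₁-identity : ∀ {X} → 𝒫₁ (id {X}) ≈ id
  𝒫₁-identity {X} = 𝒫-ext to from
    where
    to : ∀ {T} (a : T ⇒ X) (b : T ⇒ 𝒫₀ X) → a ∈[ 𝒫₁ id ∘ b ] → a ∈[ id ∘ b ]
    to a b r = ∈-local t t-epi
      (∈-resp (trans (sym identityˡ) over) (∘-resp-≈ˡ (sym identityˡ)) member)
      where open Witness (𝒫₁-elim r)

    from : ∀ {T} (a : T ⇒ X) (b : T ⇒ 𝒫₀ X) → a ∈[ id ∘ b ] → a ∈[ 𝒫₁ id ∘ b ]
    from a b r = 𝒫₁-intro (record
      { t = id ; t-epi = id-epi ; x = a
      ; member = ∈-resp refl (trans identityˡ (sym identityʳ)) r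
      ; over = trans identityˡ (sym identityʳ) })

  𝒫₁-homomorphism : ∀ {X Y Z} {f : X ⇒ Y} {g : Y ⇒ Z} → 𝒫₁ (g ∘ f) ≈ 𝒫₁ g ∘ 𝒫₁ f
  𝒫₁-homomorphism {X} {Y} {Z} {f} {g} = 𝒫-ext to from
    where
    to : ∀ {T} (a : T ⇒ Z) (b : T ⇒ 𝒫₀ X) →
         a ∈[ 𝒫₁ (g ∘ f) ∘ b ] → a ∈[ (𝒫₁ g ∘ 𝒫₁ f) ∘ b ]
    to a b r = ∈-resp refl (sym assoc) (𝒫₁-intro (record
      { t = t ; t-epi = t-epi ; x = f ∘ x
      ; member = ∈-resp refl (sym assoc) (𝒫₁-intro (record
          { t = id ; t-epi = id-epi ; x = x
          ; member = ∈-resp refl (sym identityʳ) member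
          ; over = sym identityʳ }))
      ; over = trans (sym assoc) over }))
      where open Witness (𝒫₁-elim r)

    from : ∀ {T} (a : T ⇒ Z) (b : T ⇒ 𝒫₀ X) →
           a ∈[ (𝒫₁ g ∘ 𝒫₁ f) ∘ b ] → a ∈[ 𝒫₁ (g ∘ f) ∘ b ]
    from a b r = 𝒫₁-intro (record
      { t = U.t ∘ V.t ; t-epi = epi-∘ U.t-epi V.t-epi ; x = V.x
      ; member = ∈-resp refl assoc V.member
      ; over = trans (pullʳ V.over) (trans (pullˡ U.over) assoc) })
      where
      module U = Witness (𝒫₁-elim (∈-resp refl assoc r))
      module V = Witness (𝒫₁-elim (∈-resp refl assoc U.member))

  𝒫₁-resp-≈ : ∀ {X Y} {f g : X ⇒ Y} → f ≈ g → 𝒫₁ f ≈ 𝒫₁ g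
  𝒫₁-resp-≈ {X} {Y} p = 𝒫-ext (λ a b → resp p) (λ a b → resp (sym p))
    where
    resp : ∀ {T} {f g : X ⇒ Y} {y : T ⇒ Y} {b : T ⇒ 𝒫₀ X} → f ≈ g →
           y ∈[ 𝒫₁ f ∘ b ] → y ∈[ 𝒫₁ g ∘ b ]
    resp p r = 𝒫₁-intro (record
      { t = t ; t-epi = t-epi ; x = x ; member = member
      ; over = trans (∘-resp-≈ˡ (sym p)) over })
      where open Witness (𝒫₁-elim r)

  𝒫 : Endofunctor category
  𝒫 = record
    { F₀           = 𝒫₀
    ; F₁           = 𝒫₁
    ; identity     = 𝒫₁-identity
    ; homomorphism = 𝒫₁-homomorphism
    ; F-resp-≈     = 𝒫₁-resp-≈
    }

  η : ∀ X → X ⇒ 𝒫₀ X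
  η X = ξ ⟨ id , id ⟩ (graph-mono id)

  Relation : Obj → Obj → Set (o ⊔ ℓ ⊔ e)
  Relation X Y = Subobject category (X ×ₒ Y)

  module _ (F : Endofunctor category) where
    open Functor F using (F₀)
    open Functor (𝒫 ∘F F) using () renaming (F₀ to 𝒫F₀; F₁ to 𝒫F₁)

    IsToposalAMBisimulation : ∀ {X Y} → Coalgebra F X → Coalgebra F Y →
                              Relation X Y → Set (o ⊔ ℓ ⊔ e)
    IsToposalAMBisimulation {X} {Y} α β S =
      ∀ {R} (r : R ⇒ X ×ₒ Y) (r-mono : Mono category r) →
      SameSubobject category (subobject r r-mono) S →
      Σ[ W ∈ R ⇒ 𝒫F₀ R ]
        (η (F₀ X) ×₁ η (F₀ Y)) ∘ (α ×₁ β) ∘ r ≈ ⟨ 𝒫F₁ π₁ , 𝒫F₁ π₂ ⟩ ∘ 𝒫F₁ r ∘ W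

{-# OPTIONS --safe #-}

-- From bisimulation to span, take Z = R, f = π₁ r, g = π₂ r and γ = W.
-- Conversely, factor ⟨f , g⟩ as a mono r after an epi d.  Without choice d has
-- no section along which to transport γ, so W sends a point of R to the union
-- of 𝒫Fd (γ z) over all z in its d-fibre.  Applying 𝒫F(πᵢ r) gives a union of
-- singletons which all coincide, and since d is epi the fibre is locally
-- inhabited, so the union is that singleton.

module Submission where

open import Level using (Level; _⊔_)
open import Data.Product using (Σ-syntax; _×_; _,_; proj₁; proj₂)
open import Function.Bundles using (_⇔_; mk⇔; module Equivalence)
open import Defs

module FibrewiseUnion {o ℓ e : Level} (𝒞 : Topos o ℓ e) where
  open ToposTheory 𝒞
  open Equiv
  open HomReasoning

  module _ {Z R A : Obj} (d : Z ⇒ R) (σ : Z ⇒ 𝒫₀ A) where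
    private
      module P = Pullback (pullback (id ×₁ σ) (∈ A))
      open Im ((id ×₁ d) ∘ P.p₁)

    -- `P.p₁` is the subobject of all (a , z) with a in σ z. Its image under `id ×₁ d` is the
    -- relation "a lies in σ z for some z over b", and `⋃` is the transpose of that relation.
    ⋃ : R ⇒ 𝒫₀ A
    ⋃ = ξ monoPart mono

    ∈-⋃-intro : ∀ {T} {a : T ⇒ A} {z : T ⇒ Z} → a ∈[ σ ∘ z ] → a ∈[ ⋃ ∘ (d ∘ z) ]
    ∈-⋃-intro {a = a} {z} a∈σz = ξ-intro monoPart mono (epiPart ∘ k , (begin
      monoPart ∘ (epiPart ∘ k)    ≈⟨ pullˡ factors ⟩
      ((id ×₁ d) ∘ P.p₁) ∘ k      ≈⟨ pullʳ p₁k≈ ⟩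
      (id ×₁ d) ∘ ⟨ a , z ⟩       ≈⟨ id×₁-⟨⟩ ⟩
      ⟨ a , d ∘ z ⟩               ∎))
      where
      az-in : ⟨ a , z ⟩ liesIn P.p₁
      az-in = P.p₁-factors (liesIn-resp (sym id×₁-⟨⟩) a∈σz)
      k = proj₁ az-in
      p₁k≈ = proj₂ az-in

    -- The epi part of an image need not split, so the index `z` is only asked for after restriction
    -- along a cover `t`.
    record FibreMember {T} (a : T ⇒ A) (b : T ⇒ R) : Set (o ⊔ ℓ ⊔ e) where
      field
        {cover} : Obj
        t       : cover ⇒ T
        t-epi   : Epi category t
        z       : cover ⇒ Z
        over    : d ∘ z ≈ b ∘ t
        member  : a ∘ t ∈[ σ ∘ z ]

    ∈-⋃-elim : ∀ {T} {a : T ⇒ A} {b : T ⇒ R} → a ∈[ ⋃ ∘ b ] → FibreMember a b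
    ∈-⋃-elim {a = a} {b} a∈⋃b = record
      { t      = Q.p₁
      ; t-epi  = epi-stable epi Q
      ; z      = π₂ ∘ y
      ; over   = ⟨⟩-inj₂ image≈
      ; member = ∈-resp (trans (sym identityˡ) (⟨⟩-inj₁ image≈)) refl
                   (liesIn-resp (trans (∘-resp-≈ʳ (sym ⟨⟩-η)) id×₁-⟨⟩)
                     (P.p₁-factors⁻¹ (Q.p₂ , refl)))
      }
      where
      ab-in : ⟨ a , b ⟩ liesIn monoPart
      ab-in = ξ-elim monoPart mono a∈⋃b
      Q = pullback (proj₁ ab-in) epiPart
      module Q = Pullback Q
      -- Over the cover `Q.p₁`, `y` is a pair of an element and an index above the restriction of (a
      -- , b).
      y = P.p₁ ∘ Q.p₂

      image≈ : ⟨ id ∘ (π₁ ∘ y) , d ∘ (π₂ ∘ y) ⟩ ≈ ⟨ a ∘ Q.p₁ , b ∘ Q.p₁ ⟩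
      image≈ = begin
        ⟨ id ∘ (π₁ ∘ y) , d ∘ (π₂ ∘ y) ⟩    ≈⟨ ×₁-⟨⟩ ⟨
        (id ×₁ d) ∘ ⟨ π₁ ∘ y , π₂ ∘ y ⟩     ≈⟨ ∘-resp-≈ʳ ⟨⟩-η ⟩
        (id ×₁ d) ∘ (P.p₁ ∘ Q.p₂)           ≈⟨ pullˡ (sym factors) ⟩
        (monoPart ∘ epiPart) ∘ Q.p₂         ≈⟨ pullʳ (sym Q.commute) ⟩
        monoPart ∘ (proj₁ ab-in ∘ Q.p₁)     ≈⟨ pullˡ (proj₂ ab-in) ⟩
        ⟨ a , b ⟩ ∘ Q.p₁                    ≈⟨ ⟨⟩-∘ ⟩
        ⟨ a ∘ Q.p₁ , b ∘ Q.p₁ ⟩             ∎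

  𝒫₁-∈ : ∀ {A B T} {h : A ⇒ B} {a : T ⇒ A} {b : T ⇒ 𝒫₀ A} →
         a ∈[ b ] → h ∘ a ∈[ 𝒫₁ h ∘ b ]
  𝒫₁-∈ a∈b = 𝒫₁-intro record
    { t = id ; t-epi = id-epi ; x = _
    ; member = ∈-resp refl (sym identityʳ) a∈b
    ; over = sym identityʳ }

  -- A family of images constant on the fibres of d is the image of the union;
  -- that d is epi excludes empty unions.
  𝒫₁-⋃ : ∀ {Z R A B} {d : Z ⇒ R} {σ : Z ⇒ 𝒫₀ A} {h : A ⇒ B} {δ : R ⇒ 𝒫₀ B} →
          Epi category d → 𝒫₁ h ∘ σ ≈ δ ∘ d → 𝒫₁ h ∘ ⋃ d σ ≈ δ
  𝒫₁-⋃ {Z} {R} {A} {B} {d} {σ} {h} {δ} d-epi hσ≈δd = 𝒫-ext to from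
    where
    to : ∀ {T} (a : T ⇒ B) (b : T ⇒ R) → a ∈[ (𝒫₁ h ∘ ⋃ d σ) ∘ b ] → a ∈[ δ ∘ b ]
    -- The first cover supplies an h-preimage of `a` in the union, the second an index in the fibre
    -- over `b` whose set contains that preimage. Membership in δ b is then checked on the composite
    -- cover.
    to a b a∈ = ∈-local (U.t ∘ V.t) (epi-∘ U.t-epi V.t-epi)
      (∈-resp (trans (pullˡ U.over) assoc)
        (begin
          𝒫₁ h ∘ (σ ∘ V.z)         ≈⟨ pullˡ hσ≈δd ⟩
          (δ ∘ d) ∘ V.z            ≈⟨ pullʳ V.over ⟩
          δ ∘ ((b ∘ U.t) ∘ V.t)    ≈⟨ ∘-resp-≈ʳ assoc ⟩
          δ ∘ (b ∘ (U.t ∘ V.t))    ≈⟨ assoc ⟨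
          (δ ∘ b) ∘ (U.t ∘ V.t)    ∎)
        (𝒫₁-∈ V.member))
      where
      module U = Witness (𝒫₁-elim (∈-resp refl assoc a∈))
      module V = FibreMember (∈-⋃-elim d σ (∈-resp refl assoc U.member))

    from : ∀ {T} (a : T ⇒ B) (b : T ⇒ R) → a ∈[ δ ∘ b ] → a ∈[ (𝒫₁ h ∘ ⋃ d σ) ∘ b ]
    from a b a∈δb = ∈-resp refl (sym assoc) (𝒫₁-intro record
      { t      = Q.p₁ ∘ U.t
      ; t-epi  = epi-∘ (epi-stable d-epi Q) U.t-epi
      ; x      = U.x
      ; member = ∈-resp refl
          (begin
            ⋃ d σ ∘ (d ∘ (Q.p₂ ∘ U.t))     ≈⟨ ∘-resp-≈ʳ (pullˡ (sym Q.commute)) ⟩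
            ⋃ d σ ∘ ((b ∘ Q.p₁) ∘ U.t)     ≈⟨ ∘-resp-≈ʳ assoc ⟩
            ⋃ d σ ∘ (b ∘ (Q.p₁ ∘ U.t))     ≈⟨ assoc ⟨
            (⋃ d σ ∘ b) ∘ (Q.p₁ ∘ U.t)     ∎)
          (∈-⋃-intro d σ (∈-resp refl assoc U.member))
      ; over   = trans U.over assoc
      })
      where
      -- Pulling the epi `d` back along `b` gives a cover on which `b` has a preimage `Q.p₂` in `Z`.
      -- There δ b is the image of σ at that preimage, which yields an element of the union.
      Q = pullback b d
      module Q = Pullback Q
      module U = Witness (𝒫₁-elim (∈-resp refl
        (begin
          (δ ∘ b) ∘ Q.p₁          ≈⟨ pullʳ Q.commute ⟩
          δ ∘ (d ∘ Q.p₂)          ≈⟨ pullˡ (sym hσ≈δd) ⟩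
          (𝒫₁ h ∘ σ) ∘ Q.p₂       ≈⟨ assoc ⟩
          𝒫₁ h ∘ (σ ∘ Q.p₂)       ∎)
        (∈-∘ Q.p₁ a∈δb)))

module Bisimulation {o ℓ e : Level} (𝒞 : Topos o ℓ e)
  (F : Endofunctor (Topos.category 𝒞)) where
  open ToposTheory 𝒞
  open FibrewiseUnion 𝒞
  open Functor F using (F₀)
  module 𝒫F = Functor (𝒫 ∘F F)
  open Equiv
  open HomReasoning

  -- By functoriality, applying 𝒫Fh to 𝒫Fd ∘ γ gives 𝒫Ff ∘ γ, hence δ ∘ h ∘ d, which is constant on
  -- the fibres of `d`. The structure on `R` depends only on `d` and `γ`, so the same one serves
  -- both legs of a span.
  coalgebraHom-descends : ∀ {Z R X} {d : Z ⇒ R} {h : R ⇒ X} {f : Z ⇒ X}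
    {γ : Coalgebra (𝒫 ∘F F) Z} {δ : Coalgebra (𝒫 ∘F F) X} →
    Epi category d → h ∘ d ≈ f → IsCoalgebraHom (𝒫 ∘F F) γ δ f →
    IsCoalgebraHom (𝒫 ∘F F) (⋃ d (𝒫F.F₁ d ∘ γ)) δ h
  coalgebraHom-descends {d = d} {h} {f} {γ} {δ} d-epi hd≈f f-hom = 𝒫₁-⋃ d-epi (begin
    𝒫F.F₁ h ∘ (𝒫F.F₁ d ∘ γ)   ≈⟨ pullˡ (sym 𝒫F.homomorphism) ⟩
    𝒫F.F₁ (h ∘ d) ∘ γ         ≈⟨ ∘-resp-≈ˡ (𝒫F.F-resp-≈ hd≈f) ⟩
    𝒫F.F₁ f ∘ γ               ≈⟨ f-hom ⟩
    δ ∘ f                     ≈⟨ ∘-resp-≈ʳ hd≈f ⟨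
    δ ∘ (h ∘ d)               ≈⟨ assoc ⟨
    (δ ∘ h) ∘ d               ∎)

  module _ {X Y : Obj} (α : Coalgebra F X) (β : Coalgebra F Y) where

    module _ {R : Obj} (r : R ⇒ X ×ₒ Y) (W : R ⇒ 𝒫F.F₀ R) where

      coalgebras-componentwise : (η (F₀ X) ×₁ η (F₀ Y)) ∘ (α ×₁ β) ∘ r ≈
             ⟨ (η (F₀ X) ∘ α) ∘ (π₁ ∘ r) , (η (F₀ Y) ∘ β) ∘ (π₂ ∘ r) ⟩
      coalgebras-componentwise = begin
        (η (F₀ X) ×₁ η (F₀ Y)) ∘ (α ×₁ β) ∘ r
          ≈⟨ ∘-resp-≈ʳ (∘-resp-≈ʳ (sym ⟨⟩-η)) ⟩
        (η (F₀ X) ×₁ η (F₀ Y)) ∘ (α ×₁ β) ∘ ⟨ π₁ ∘ r , π₂ ∘ r ⟩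
          ≈⟨ ∘-resp-≈ʳ ×₁-⟨⟩ ⟩
        (η (F₀ X) ×₁ η (F₀ Y)) ∘ ⟨ α ∘ (π₁ ∘ r) , β ∘ (π₂ ∘ r) ⟩
          ≈⟨ ×₁-⟨⟩ ⟩
        ⟨ η (F₀ X) ∘ (α ∘ (π₁ ∘ r)) , η (F₀ Y) ∘ (β ∘ (π₂ ∘ r)) ⟩
          ≈⟨ ⟨⟩-cong (sym assoc) (sym assoc) ⟩
        ⟨ (η (F₀ X) ∘ α) ∘ (π₁ ∘ r) , (η (F₀ Y) ∘ β) ∘ (π₂ ∘ r) ⟩
          ∎

      witness-componentwise : ⟨ 𝒫F.F₁ π₁ , 𝒫F.F₁ π₂ ⟩ ∘ 𝒫F.F₁ r ∘ W ≈
             ⟨ 𝒫F.F₁ (π₁ ∘ r) ∘ W , 𝒫F.F₁ (π₂ ∘ r) ∘ W ⟩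
      witness-componentwise =
        trans ⟨⟩-∘ (⟨⟩-cong (pullˡ (sym 𝒫F.homomorphism)) (pullˡ (sym 𝒫F.homomorphism)))

      -- Both sides are morphisms into a product, so they can be compared componentwise. This
      -- reduces the theorem to homomorphisms out of a common coalgebra.
      AM-equation⇔homs :
        ((η (F₀ X) ×₁ η (F₀ Y)) ∘ (α ×₁ β) ∘ r ≈ ⟨ 𝒫F.F₁ π₁ , 𝒫F.F₁ π₂ ⟩ ∘ 𝒫F.F₁ r ∘ W)
        ⇔
        (IsCoalgebraHom (𝒫 ∘F F) W (η (F₀ X) ∘ α) (π₁ ∘ r) ×
         IsCoalgebraHom (𝒫 ∘F F) W (η (F₀ Y) ∘ β) (π₂ ∘ r))
      AM-equation⇔homs = mk⇔
        (λ eq → let eq′ = trans (sym witness-componentwise)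
                                (trans (sym eq) coalgebras-componentwise)
                in ⟨⟩-inj₁ eq′ , ⟨⟩-inj₂ eq′)
        (λ (hom₁ , hom₂) → trans coalgebras-componentwise
          (trans (sym (⟨⟩-cong hom₁ hom₂)) (sym witness-componentwise)))

corollary4p6 : ∀ {o ℓ e : Level} (𝒞 : Topos o ℓ e) →
    let open ToposTheory 𝒞 in
    (F : Endofunctor category) →
    let open Functor F using (F₀) in
    {X Y : Obj} (α : Coalgebra F X) (β : Coalgebra F Y)
    (∗ : Obj) (p : ∗ ⇒ X) (q : ∗ ⇒ Y) →
    (Σ[ R ∈ Obj ] Σ[ r ∈ R ⇒ X ×ₒ Y ] Σ[ r-mono ∈ Mono category r ]
    IsToposalAMBisimulation F α β (subobject r r-mono) ×
    (Σ[ c ∈ ∗ ⇒ R ] r ∘ c ≈ ⟨ p , q ⟩))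
    ⇔
    (Σ[ Z ∈ Obj ] Σ[ f ∈ Z ⇒ X ] Σ[ g ∈ Z ⇒ Y ]
    Σ[ γ ∈ Coalgebra (𝒫 ∘F F) Z ] Σ[ w ∈ ∗ ⇒ Z ]
    IsCoalgebraHom (𝒫 ∘F F) γ (η (F₀ X) ∘ α) f ×
    IsCoalgebraHom (𝒫 ∘F F) γ (η (F₀ Y) ∘ β) g ×
    f ∘ w ≈ p ×
    g ∘ w ≈ q)
corollary4p6 𝒞 F {X} {Y} α β ∗ p q = mk⇔ to from
  where
  open ToposTheory 𝒞
  open FibrewiseUnion 𝒞
  open Bisimulation 𝒞 F
  open Functor F using (F₀)
  open Equiv
  open HomReasoning
  module Eqv {R} (r : R ⇒ X ×ₒ Y) (W : R ⇒ 𝒫F.F₀ R) =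
    Equivalence (AM-equation⇔homs α β r W)

  to : (Σ[ R ∈ Obj ] Σ[ r ∈ R ⇒ X ×ₒ Y ] Σ[ r-mono ∈ Mono category r ]
        IsToposalAMBisimulation F α β (subobject r r-mono) ×
        (Σ[ c ∈ ∗ ⇒ R ] r ∘ c ≈ ⟨ p , q ⟩)) →
       (Σ[ Z ∈ Obj ] Σ[ f ∈ Z ⇒ X ] Σ[ g ∈ Z ⇒ Y ]
        Σ[ γ ∈ Coalgebra (𝒫 ∘F F) Z ] Σ[ w ∈ ∗ ⇒ Z ]
        IsCoalgebraHom (𝒫 ∘F F) γ (η (F₀ X) ∘ α) f ×
        IsCoalgebraHom (𝒫 ∘F F) γ (η (F₀ Y) ∘ β) g ×
        f ∘ w ≈ p × g ∘ w ≈ q)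
  to (R , r , r-mono , bisim , c , rc≈pq) =
    -- Among the monos representing the relation, `r` itself is chosen, with identities as
    -- comparison maps.
    let (W , eq)      = bisim r r-mono ((id , identityʳ) , (id , identityʳ))
        (hom₁ , hom₂) = Eqv.to r W eq
    in R , π₁ ∘ r , π₂ ∘ r , W , c , hom₁ , hom₂ ,
       trans (pullʳ rc≈pq) project₁ , trans (pullʳ rc≈pq) project₂

  from : (Σ[ Z ∈ Obj ] Σ[ f ∈ Z ⇒ X ] Σ[ g ∈ Z ⇒ Y ]
          Σ[ γ ∈ Coalgebra (𝒫 ∘F F) Z ] Σ[ w ∈ ∗ ⇒ Z ]
          IsCoalgebraHom (𝒫 ∘F F) γ (η (F₀ X) ∘ α) f ×
          IsCoalgebraHom (𝒫 ∘F F) γ (η (F₀ Y) ∘ β) g ×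
          f ∘ w ≈ p × g ∘ w ≈ q) →
         (Σ[ R ∈ Obj ] Σ[ r ∈ R ⇒ X ×ₒ Y ] Σ[ r-mono ∈ Mono category r ]
          IsToposalAMBisimulation F α β (subobject r r-mono) ×
          (Σ[ c ∈ ∗ ⇒ R ] r ∘ c ≈ ⟨ p , q ⟩))
  from (Z , f , g , γ , w , f-hom , g-hom , fw≈p , gw≈q) =
    image , monoPart , mono , bisim , epiPart ∘ w , (begin
      monoPart ∘ (epiPart ∘ w)   ≈⟨ pullˡ factors ⟩
      ⟨ f , g ⟩ ∘ w              ≈⟨ ⟨⟩-∘ ⟩
      ⟨ f ∘ w , g ∘ w ⟩          ≈⟨ ⟨⟩-cong fw≈p gw≈q ⟩
      ⟨ p , q ⟩                  ∎)
    where
    open Im ⟨ f , g ⟩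

    bisim : IsToposalAMBisimulation F α β (subobject monoPart mono)
    bisim {R} r r-mono ((i , mi≈r) , (j , rj≈m)) = W , Eqv.from r W
      ( coalgebraHom-descends d-epi (trans (pullʳ rd≈fg) project₁) f-hom
      , coalgebraHom-descends d-epi (trans (pullʳ rd≈fg) project₂) g-hom )
      where
      -- A witness is due on every mono `r` representing the image. Composing with the comparison
      -- `j` makes `Z` cover `R` directly, so nothing has to be transported from `image`.
      d = j ∘ epiPart
      W = ⋃ d (𝒫F.F₁ d ∘ γ)

      rd≈fg : r ∘ d ≈ ⟨ f , g ⟩
      rd≈fg = trans (pullˡ rj≈m) factors

      -- Cancelling the mono `r` makes `i` a section of `j`, so `j` is a split epi.
      ji≈id : j ∘ i ≈ id
      ji≈id = r-mono _ _ (trans (pullˡ rj≈m) (trans mi≈r (sym identityʳ)))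

      j-epi : Epi category j
      j-epi u v uj≈vj = begin
        u              ≈⟨ identityʳ ⟨
        u ∘ id         ≈⟨ ∘-resp-≈ʳ ji≈id ⟨
        u ∘ (j ∘ i)    ≈⟨ pullˡ uj≈vj ⟩
        (v ∘ j) ∘ i    ≈⟨ pullʳ ji≈id ⟩
        v ∘ id         ≈⟨ identityʳ ⟩
        v              ∎

      d-epi : Epi category d
      d-epi = epi-∘ j-epi epi
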